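{- Let $k\ge 1$ be an integer, let $P=(E,r)$ be a $k$-polymatroid and let $P^*$ be its ($k$-)dual. Then $$T_k(P^*;x,y)=T_k(P;y,x).$$
   Context: A polymatroid is a pair $P=(E,r)$ with $E$ a finite set and $r:2^E\to\mathbb{Z}$ such that $r(\emptyset)=0$, $r(A)\le r(B)$ whenever $A\subseteq B$, and $r(A)+r(B)\ge r(A\cup B)+r(A\cap B)$ for all $A,B\subseteq E$. It is a $k$-polymatroid if $r(\{e\})\le k$ for all $e\in E$. The $k$-dual of a $k$-polymatroid $P=(E,r)$ is $P^*=(E,r^*)$ with $r^*(A)=k|A|+r(E\setminus A)-r(E)$ for $A\subseteq E$ (again a $k$-polymatroid). $k$-polymatroid Tutte polynomial: $T_k(P;x,y)=\sum_{A\subseteq E}(x-1)^{r(E)-r(A)}(y-1)^{k|A|-r(A)}$. -}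

module Defs where

open import Algebra.Bundles using (CommutativeRing)
import Algebra.Properties.Semiring.Exp as SemiringExp
import Algebra.Lattice.Properties.BooleanAlgebra as BooleanAlgebraProperties
open import Data.Fin.Base using (Fin; zero; suc)
open import Data.Fin.Subset using (Subset; inside; outside; _⊆_; _∪_; _∩_; ∁; ⊤; ⊥; ⁅_⁆; ∣_∣)
open import Data.Fin.Subset.Properties
  using (∪-identityʳ; drop-∷-⊆; ⊥⊆; ⊆⊤; ∣⊥∣≡0; ∣⁅x⁆∣≡1; ∣p∣≤n; ∣∁p∣≡n∸∣p∣; p⊆q⇒∁p⊇∁q; ∪-∩-booleanAlgebra)
open import Data.Integer.Base as ℤ using (ℤ; +_; _+_; _-_; _*_; _≤_; 0ℤ; 1ℤ)
import Data.Integer.Properties as ℤ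
open import Data.Integer.Tactic.RingSolver using (solve-∀)
open import Data.Nat.Base as ℕ using (ℕ; zero; suc)
import Data.Nat.Properties as ℕ
open import Data.Vec.Base using ([]; _∷_; here)
open import Function.Base using (_∘_)
open import Level using (Level)
open import Relation.Binary.PropositionalEquality
  using (_≡_; refl; sym; trans; cong; cong₂; subst; subst₂)

-- The ground set E is Fin n, and 2^E is Subset n, so that ⊤ is E itself and
-- ∁ A is E ∖ A.

record Polymatroid (n : ℕ) : Set where
  field
    r           : Subset n → ℤ
    r-empty     : r ⊥ ≡ 0ℤ
    monotone    : ∀ A B → A ⊆ B → r A ≤ r B
    submodular  : ∀ A B → r (A ∪ B) + r (A ∩ B) ≤ r A + r B

record KPolymatroid (k n : ℕ) : Set where
  field
    polymatroid : Polymatroid n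
  open Polymatroid polymatroid public
  field
    bounded     : ∀ e → r ⁅ e ⁆ ≤ + k

private
  cancel : ∀ c a b → a + c ≤ b + c → a ≤ b
  cancel c a b p = subst₂ _≤_ (eq a c) (eq b c) (ℤ.+-monoˡ-≤ (ℤ.- c) p)
    where
    eq : ∀ a c → (a + c) - c ≡ a
    eq = solve-∀

  *-suc : ∀ k m → + k * + suc m ≡ + k + + k * + m
  *-suc k m = ℤ.*-suc (+ k) (+ m)

  growth : ∀ (k : ℕ) {n} (f : Subset n → ℤ) →
           (∀ A e → f (A ∪ ⁅ e ⁆) ≤ f A + + k) →
           ∀ A B → A ⊆ B → f B + + k * + ∣ A ∣ ≤ f A + + k * + ∣ B ∣
  growth k f step [] [] A⊆B = ℤ.≤-refl
  growth k f step (outside ∷ A) (outside ∷ B) A⊆B =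
    growth k (f ∘ (outside ∷_)) (λ C e → step (outside ∷ C) (suc e)) A B (drop-∷-⊆ A⊆B)
  growth k f step (outside ∷ A) (inside ∷ B) A⊆B = ℤ.≤-trans
    (growth k (f ∘ (inside ∷_)) (λ C e → step (inside ∷ C) (suc e)) A B (drop-∷-⊆ A⊆B))
    (subst₂ _≤_ refl
      (trans (ℤ.+-assoc (f (outside ∷ A)) (+ k) (+ k * + ∣ B ∣))
             (cong (_+_ (f (outside ∷ A))) (sym (*-suc k ∣ B ∣))))
      (ℤ.+-monoˡ-≤ (+ k * + ∣ B ∣)
        (subst (λ C → f (inside ∷ C) ≤ f (outside ∷ A) + + k) (∪-identityʳ A)
          (step (outside ∷ A) zero))))
  growth k f step (inside ∷ A) (outside ∷ B) A⊆B with () ← A⊆B here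
  growth k f step (inside ∷ A) (inside ∷ B) A⊆B = subst₂ _≤_
    (trans (shift (f (inside ∷ B)) (+ k) (+ k * + ∣ A ∣)) (cong (_+_ (f (inside ∷ B))) (sym (*-suc k ∣ A ∣))))
    (trans (shift (f (inside ∷ A)) (+ k) (+ k * + ∣ B ∣)) (cong (_+_ (f (inside ∷ A))) (sym (*-suc k ∣ B ∣))))
    (ℤ.+-monoˡ-≤ (+ k)
      (growth k (f ∘ (inside ∷_)) (λ C e → step (inside ∷ C) (suc e)) A B (drop-∷-⊆ A⊆B)))
    where
    shift : ∀ x k y → (x + y) + k ≡ x + (k + y)
    shift = solve-∀

  ∣∁∣ : ∀ {n} (A : Subset n) → + ∣ A ∣ + + ∣ ∁ A ∣ ≡ + n
  ∣∁∣ A = cong +_ (trans (cong (∣ A ∣ ℕ.+_) (∣∁p∣≡n∸∣p∣ A)) (ℕ.m+[n∸m]≡n (∣p∣≤n A)))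

  ∣∪∣+∣∩∣ : ∀ {n} (A B : Subset n) → ∣ A ∪ B ∣ ℕ.+ ∣ A ∩ B ∣ ≡ ∣ A ∣ ℕ.+ ∣ B ∣
  ∣∪∣+∣∩∣ [] [] = refl
  ∣∪∣+∣∩∣ (outside ∷ A) (outside ∷ B) = ∣∪∣+∣∩∣ A B
  ∣∪∣+∣∩∣ (outside ∷ A) (inside  ∷ B) = trans (cong suc (∣∪∣+∣∩∣ A B)) (sym (ℕ.+-suc ∣ A ∣ ∣ B ∣))
  ∣∪∣+∣∩∣ (inside  ∷ A) (outside ∷ B) = cong suc (∣∪∣+∣∩∣ A B)
  ∣∪∣+∣∩∣ (inside  ∷ A) (inside  ∷ B) = cong suc
    (trans (ℕ.+-suc ∣ A ∪ B ∣ ∣ A ∩ B ∣) (trans (cong suc (∣∪∣+∣∩∣ A B)) (sym (ℕ.+-suc ∣ A ∣ ∣ B ∣))))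

  ∁⊥≡⊤ : ∀ {n} → ∁ (⊥ {n}) ≡ ⊤
  ∁⊥≡⊤ {n} = BooleanAlgebraProperties.¬⊥≈⊤ (∪-∩-booleanAlgebra n)

  ∁-∪ : ∀ {n} (A B : Subset n) → ∁ (A ∪ B) ≡ ∁ A ∩ ∁ B
  ∁-∪ {n} = BooleanAlgebraProperties.deMorgan₂ (∪-∩-booleanAlgebra n)

  ∁-∩ : ∀ {n} (A B : Subset n) → ∁ (A ∩ B) ≡ ∁ A ∪ ∁ B
  ∁-∩ {n} = BooleanAlgebraProperties.deMorgan₁ (∪-∩-booleanAlgebra n)

module _ {k n : ℕ} (P : KPolymatroid k n) where
  open KPolymatroid P

  dualRank : Subset n → ℤ
  dualRank A = + k * + ∣ A ∣ + r (∁ A) - r ⊤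

  private
    r-nonneg : ∀ A → 0ℤ ≤ r A
    r-nonneg A = subst (_≤ r A) r-empty (monotone ⊥ A ⊥⊆)

    r-step : ∀ A e → r (A ∪ ⁅ e ⁆) ≤ r A + + k
    r-step A e = ℤ.≤-trans
      (subst (_≤ r (A ∪ ⁅ e ⁆) + r (A ∩ ⁅ e ⁆)) (ℤ.+-identityʳ _)
        (ℤ.+-monoʳ-≤ (r (A ∪ ⁅ e ⁆)) (r-nonneg (A ∩ ⁅ e ⁆))))
      (ℤ.≤-trans (submodular A ⁅ e ⁆) (ℤ.+-monoʳ-≤ (r A) (bounded e)))

    r-growth : ∀ A B → A ⊆ B → r B + + k * + ∣ A ∣ ≤ r A + + k * + ∣ B ∣
    r-growth = growth k r r-step

    dual-empty : dualRank ⊥ ≡ 0ℤ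
    dual-empty = trans
      (cong₂ (λ m A → + k * + m + r A - r ⊤) (∣⊥∣≡0 n) ∁⊥≡⊤)
      (eq (+ k) (r ⊤))
      where
      eq : ∀ k x → k * 0ℤ + x - x ≡ 0ℤ
      eq = solve-∀

    dual-monotone : ∀ A B → A ⊆ B → dualRank A ≤ dualRank B
    dual-monotone A B A⊆B = ℤ.+-monoˡ-≤ (ℤ.- r ⊤)
      (cancel (+ k * + ∣ ∁ A ∣ + + k * + ∣ ∁ B ∣) (+ k * + ∣ A ∣ + r (∁ A)) (+ k * + ∣ B ∣ + r (∁ B)) (subst₂ _≤_
        (trans (cong (λ m → r (∁ A) + + k * + ∣ ∁ B ∣ + + k * m) (sym (∣∁∣ A)))
               (eqA (+ k) (+ ∣ A ∣) (+ ∣ ∁ A ∣) (+ ∣ ∁ B ∣) (r (∁ A))))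
        (trans (cong (λ m → r (∁ B) + + k * + ∣ ∁ A ∣ + + k * m) (sym (∣∁∣ B)))
               (eqB (+ k) (+ ∣ B ∣) (+ ∣ ∁ A ∣) (+ ∣ ∁ B ∣) (r (∁ B))))
        (ℤ.+-monoˡ-≤ (+ k * + n) (r-growth (∁ B) (∁ A) (p⊆q⇒∁p⊇∁q A⊆B)))))
      where
      eqA : ∀ k a a′ b′ x → x + k * b′ + k * (a + a′) ≡ (k * a + x) + (k * a′ + k * b′)
      eqA = solve-∀
      eqB : ∀ k b a′ b′ x → x + k * a′ + k * (b + b′) ≡ (k * b + x) + (k * a′ + k * b′)
      eqB = solve-∀

    dual-submodular : ∀ A B → dualRank (A ∪ B) + dualRank (A ∩ B) ≤ dualRank A + dualRank B
    dual-submodular A B = subst₂ _≤_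
      (trans (cong (λ m → + k * m - (r ⊤ + r ⊤) + (r (∁ A ∪ ∁ B) + r (∁ A ∩ ∁ B)))
                   (sym (cong +_ (∣∪∣+∣∩∣ A B))))
        (trans (eq₁ (+ k) (+ ∣ A ∪ B ∣) (+ ∣ A ∩ B ∣) (r ⊤) (r (∁ A ∩ ∁ B)) (r (∁ A ∪ ∁ B)))
          (sym (cong₂ (λ X Y → (+ k * + ∣ A ∪ B ∣ + r X - r ⊤) + (+ k * + ∣ A ∩ B ∣ + r Y - r ⊤))
                 (∁-∪ A B) (∁-∩ A B)))))
      (eq₂ (+ k) (+ ∣ A ∣) (+ ∣ B ∣) (r ⊤) (r (∁ A)) (r (∁ B)))
      (ℤ.+-monoʳ-≤ (+ k * (+ ∣ A ∣ + + ∣ B ∣) - (r ⊤ + r ⊤)) (submodular (∁ A) (∁ B)))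
      where
      eq₁ : ∀ k u v t x y → k * (u + v) - (t + t) + (y + x) ≡ (k * u + x - t) + (k * v + y - t)
      eq₁ = solve-∀
      eq₂ : ∀ k a b t x y → k * (a + b) - (t + t) + (x + y) ≡ (k * a + x - t) + (k * b + y - t)
      eq₂ = solve-∀

    dual-bounded : ∀ e → dualRank ⁅ e ⁆ ≤ + k
    dual-bounded e = subst₂ _≤_
      (cong (λ m → + k * + m + r (∁ ⁅ e ⁆) - r ⊤) (sym (∣⁅x⁆∣≡1 e)))
      (eq (+ k) (r ⊤))
      (ℤ.+-monoˡ-≤ (ℤ.- r ⊤) (ℤ.+-monoʳ-≤ (+ k * 1ℤ) (monotone (∁ ⁅ e ⁆) ⊤ ⊆⊤)))
      where
      eq : ∀ k t → k * 1ℤ + t - t ≡ k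
      eq = solve-∀

  dual : KPolymatroid k n
  dual = record
    { polymatroid = record
      { r          = dualRank
      ; r-empty    = dual-empty
      ; monotone   = dual-monotone
      ; submodular = dual-submodular
      }
    ; bounded = dual-bounded
    }

  -- Both exponents of the Tutte polynomial are nonnegative integers, as shown
  -- by the two lemmas below; the absolute value only serves as the
  -- conversion from ℤ to ℕ.
  corank nullity : Subset n → ℕ
  corank  A = ℤ.∣ r ⊤ - r A ∣
  nullity A = ℤ.∣ + k * + ∣ A ∣ - r A ∣

  +corank : ∀ A → + corank A ≡ r ⊤ - r A
  +corank A = ℤ.0≤i⇒+∣i∣≡i (ℤ.i≤j⇒0≤j-i (monotone A ⊤ ⊆⊤))

  +nullity : ∀ A → + nullity A ≡ + k * + ∣ A ∣ - r A
  +nullity A = ℤ.0≤i⇒+∣i∣≡i (ℤ.i≤j⇒0≤j-i {r A} {+ k * + ∣ A ∣} (subst₂ _≤_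
    (trans (cong (λ m → r A + + k * + m) (∣⊥∣≡0 n)) (eq (r A) (+ k)))
    (trans (cong (_+ + k * + ∣ A ∣) r-empty) (ℤ.+-identityˡ (+ k * + ∣ A ∣)))
    (r-growth ⊥ A ⊥⊆)))
    where
    eq : ∀ x k → x + k * 0ℤ ≡ x
    eq = solve-∀

-- A polynomial in ℤ[x,y] is represented by its values at all pairs x, y of
-- elements of all commutative rings. Since ℤ[x,y] is itself such a ring,
-- equality of all these values is the same as equality of the polynomials.
module _ {c ℓ : Level} (R : CommutativeRing c ℓ) where
  open CommutativeRing R
    using (Carrier; 1#; semiring)
    renaming (_+_ to _⊕_; _*_ to _⊗_; _-_ to _⊖_)
  open SemiringExp semiring using (_^_)

  sumOverSubsets : ∀ {n} → (Subset n → Carrier) → Carrier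
  sumOverSubsets {zero}  f = f []
  sumOverSubsets {suc n} f = sumOverSubsets (f ∘ (outside ∷_)) ⊕ sumOverSubsets (f ∘ (inside ∷_))

  tutte : ∀ {k n} → KPolymatroid k n → Carrier → Carrier → Carrier
  tutte P x y = sumOverSubsets λ A → ((x ⊖ 1#) ^ corank P A) ⊗ ((y ⊖ 1#) ^ nullity P A)

{-# OPTIONS --safe #-}
-- Complementation is a bijection of 2^E, and it exchanges the two exponents:
-- the corank of A in P* is the nullity of E ∖ A in P, and vice versa. So
-- complementing the summation index turns one sum into the other.
module Submission where

open import Algebra.Bundles using (CommutativeRing)
import Algebra.Properties.Semiring.Exp as SemiringExp
import Algebra.Lattice.Properties.BooleanAlgebra as BooleanAlgebraProperties
open import Data.Fin.Subset using (Subset; inside; outside; ∁; ⊤; ⊥; ∣_∣)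
open import Data.Fin.Subset.Properties using (∣⊤∣≡n; ∣p∣≤n; ∣∁p∣≡n∸∣p∣; ∪-∩-booleanAlgebra)
open import Data.Integer.Base as ℤ using (+_; 0ℤ)
open import Data.Integer.Tactic.RingSolver using (solve-∀)
open import Data.Nat.Base as ℕ using (ℕ; zero; suc; _≥_)
import Data.Nat.Properties as ℕ
open import Data.Vec.Base using ([]; _∷_)
open import Function.Base using (_∘_)
open import Relation.Binary.PropositionalEquality
  using (_≡_; sym; trans; cong; cong₂; module ≡-Reasoning)
open import Defs using (KPolymatroid; dual; dualRank; corank; nullity; sumOverSubsets; tutte)

∣⊤∣≡∣p∣+∣∁p∣ : ∀ {n} (p : Subset n) → ∣ ⊤ {n} ∣ ≡ ∣ p ∣ ℕ.+ ∣ ∁ p ∣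
∣⊤∣≡∣p∣+∣∁p∣ {n} p = trans (∣⊤∣≡n n)
  (sym (trans (cong (∣ p ∣ ℕ.+_) (∣∁p∣≡n∸∣p∣ p)) (ℕ.m+[n∸m]≡n (∣p∣≤n p))))

∁⊤≡⊥ : ∀ {n} → ∁ (⊤ {n}) ≡ ⊥
∁⊤≡⊥ {n} = BooleanAlgebraProperties.¬⊤≈⊥ (∪-∩-booleanAlgebra n)

module _ {k n : ℕ} (P : KPolymatroid k n) where
  open KPolymatroid P

  -- Since `r ⊥` is 0, the dual rank of `⊤` is k|E| - r(E). Splitting |E| as |A| + |E ∖ A| lets both
  -- k|A| and r(E) cancel in the difference of dual ranks. The integers agree before absolute values
  -- are taken.
  corank-dual : ∀ A → corank (dual P) A ≡ nullity P (∁ A)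
  corank-dual A = cong ℤ.∣_∣ (begin
    dualRank P ⊤ ℤ.- dualRank P A
      ≡⟨ cong₂ (λ m x → (+ k ℤ.* m ℤ.+ x ℤ.- r ⊤) ℤ.- dualRank P A)
           (cong +_ (∣⊤∣≡∣p∣+∣∁p∣ A)) (trans (cong r ∁⊤≡⊥) r-empty) ⟩
    (+ k ℤ.* (+ ∣ A ∣ ℤ.+ + ∣ ∁ A ∣) ℤ.+ 0ℤ ℤ.- r ⊤) ℤ.- dualRank P A
      ≡⟨ eq (+ k) (+ ∣ A ∣) (+ ∣ ∁ A ∣) (r ⊤) (r (∁ A)) ⟩
    + k ℤ.* + ∣ ∁ A ∣ ℤ.- r (∁ A) ∎)
    where
    open ≡-Reasoning
    eq : ∀ k a a′ t x →
         (k ℤ.* (a ℤ.+ a′) ℤ.+ 0ℤ ℤ.- t) ℤ.- (k ℤ.* a ℤ.+ x ℤ.- t) ≡ k ℤ.* a′ ℤ.- x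
    eq = solve-∀

  -- The term k|A| inside `dualRank P A` cancels against the k|A| of the nullity.
  nullity-dual : ∀ A → nullity (dual P) A ≡ corank P (∁ A)
  nullity-dual A = cong ℤ.∣_∣ (eq (+ k ℤ.* + ∣ A ∣) (r ⊤) (r (∁ A)))
    where
    eq : ∀ m t x → m ℤ.- (m ℤ.+ x ℤ.- t) ≡ t ℤ.- x
    eq = solve-∀

module _ {c ℓ} (R : CommutativeRing c ℓ) where
  open CommutativeRing R using (Carrier; _≈_; +-cong; +-comm) renaming (refl to ≈-refl; trans to ≈-trans)

  sumOverSubsets-cong : ∀ {n} {f g : Subset n → Carrier} → (∀ A → f A ≈ g A) →
                        sumOverSubsets R f ≈ sumOverSubsets R g
  sumOverSubsets-cong {zero}  f≈g = f≈g []
  sumOverSubsets-cong {suc n} f≈g =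
    +-cong (sumOverSubsets-cong (f≈g ∘ (outside ∷_))) (sumOverSubsets-cong (f≈g ∘ (inside ∷_)))

  -- Induction on n: complementing flips the first coordinate, so the `inside` and `outside` halves
  -- of the sum trade places, and commutativity of addition swaps them back.
  sumOverSubsets-∁ : ∀ {n} (f : Subset n → Carrier) →
                     sumOverSubsets R (f ∘ ∁) ≈ sumOverSubsets R f
  sumOverSubsets-∁ {zero}  f = ≈-refl
  sumOverSubsets-∁ {suc n} f = ≈-trans
    (+-cong (sumOverSubsets-∁ (f ∘ (inside ∷_))) (sumOverSubsets-∁ (f ∘ (outside ∷_))))
    (+-comm _ _)

proposition3p5 : (k : ℕ) → k ≥ 1 → (n : ℕ) → (P : KPolymatroid k n) →
    ∀ {c ℓ} (R : CommutativeRing c ℓ) → let open CommutativeRing R in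
    (x y : Carrier) → tutte R (dual P) x y ≈ tutte R P y x
proposition3p5 k _ n P R x y = R.trans
  (sumOverSubsets-cong R λ A → R.trans
    (R.reflexive (cong₂ (λ i j → ((x R.- R.1#) ^ i) R.* ((y R.- R.1#) ^ j))
      (corank-dual P A) (nullity-dual P A)))
    -- The power of x - 1 now carries the nullity of `∁ A` and that of y - 1 its corank; swapping
    -- the factors gives the summand of `tutte R P y x` at `∁ A`.
    (R.*-comm _ _))
  (sumOverSubsets-∁ R λ A → ((y R.- R.1#) ^ corank P A) R.* ((x R.- R.1#) ^ nullity P A))
  where
  module R = CommutativeRing R
  open SemiringExp R.semiring using (_^_)
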